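{- Let $\mathcal{G}\mathsf{L}$ be any of $\mathcal{G}\mathsf{N4}$, $\mathcal{G}\mathsf{CN4K}$, $\mathcal{G}\mathsf{CN4K}^\pm$, $\mathcal{G}\mathsf{CN4K}^\curlyvee$, $\mathcal{G}\mathsf{CN4K}^{\Join}$, $\mathcal{G}\mathsf{CN4K}^1$. The cut rule (from $\Gamma\Rightarrow\phi$ and $\phi,\Delta\Rightarrow\chi$ infer $\Gamma,\Delta\Rightarrow\chi$) is admissible in $\mathcal{G}\mathsf{L}$: if both premises are provable in $\mathcal{G}\mathsf{L}$, so is the conclusion.
   Context: Fix a countable set $\mathsf{Prop}$ of propositional variables. The language $\mathcal{L}$ is given by the grammar $\phi::=p\mid{\sim}\phi\mid(\phi\wedge\phi)\mid(\phi\vee\phi)\mid(\phi\to\phi)\mid\Box\phi\mid\Diamond\phi$ with $p\in\mathsf{Prop}$ (for $\mathcal{G}\mathsf{N4}$ only modality-free formulas are used). A sequent is $\Gamma\Rightarrow\phi$ with $\Gamma$ a finite multiset of formulas and $\phi$ a single formula. $\Gamma^\Box=\{\phi\mid\Box\phi\in\Gamma\}$, $\Gamma^\Diamond_\sim=\{{\sim}\phi\mid{\sim}\Diamond\phi\in\Gamma\}$ (multisets). Rules are written premise(s) / conclusion. Rules of $\mathcal{G}\mathsf{N4}$: axioms $p,\Gamma\Rightarrow p$ and ${\sim}p,\Gamma\Rightarrow{\sim}p$ ($p\in\mathsf{Prop}$); ${\sim}{\sim}_l$: $\phi,\Gamma\Rightarrow\psi$ / ${\sim}{\sim}\phi,\Gamma\Rightarrow\psi$;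 ${\sim}{\sim}_r$: $\Gamma\Rightarrow\phi$ / $\Gamma\Rightarrow{\sim}{\sim}\phi$; $\wedge_l$: $\phi,\chi,\Gamma\Rightarrow\psi$ / $\phi\wedge\chi,\Gamma\Rightarrow\psi$; $\wedge_r$: $\Gamma\Rightarrow\phi$ and $\Gamma\Rightarrow\chi$ / $\Gamma\Rightarrow\phi\wedge\chi$; $\vee_l$: $\phi,\Gamma\Rightarrow\psi$ and $\chi,\Gamma\Rightarrow\psi$ / $\phi\vee\chi,\Gamma\Rightarrow\psi$; $\vee_{r_1}$: $\Gamma\Rightarrow\phi$ / $\Gamma\Rightarrow\phi\vee\chi$; $\vee_{r_2}$: $\Gamma\Rightarrow\chi$ / $\Gamma\Rightarrow\phi\vee\chi$; ${\sim}\vee_l$: ${\sim}\phi,{\sim}\chi,\Gamma\Rightarrow\psi$ / ${\sim}(\phi\vee\chi),\Gamma\Rightarrow\psi$; ${\sim}\vee_r$: $\Gamma\Rightarrow{\sim}\phi$ and $\Gamma\Rightarrow{\sim}\chi$ / $\Gamma\Rightarrow{\sim}(\phi\vee\chi)$; ${\sim}\wedge_l$: ${\sim}\phi,\Gamma\Rightarrow\psi$ and ${\sim}\chi,\Gamma\Rightarrow\psi$ / ${\sim}(\phi\wedge\chi),\Gamma\Rightarrow\psi$; ${\sim}\wedge_{r_1}$: $\Gamma\Rightarrow{\sim}\phi$ / $\Gamma\Rightarrow{\sim}(\phi\wedge\chi)$; ${\sim}\wedge_{r_2}$: $\Gamma\Rightarrow{\sim}\chi$ / $\Gamma\Rightarrow{\sim}(\phi\wedge\chi)$;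 $\to_l$: $\phi\to\chi,\Gamma\Rightarrow\phi$ and $\chi,\Gamma\Rightarrow\psi$ / $\phi\to\chi,\Gamma\Rightarrow\psi$; $\to_r$: $\Gamma,\phi\Rightarrow\chi$ / $\Gamma\Rightarrow\phi\to\chi$; ${\sim}\!\to_l$: $\phi,{\sim}\chi,\Gamma\Rightarrow\psi$ / ${\sim}(\phi\to\chi),\Gamma\Rightarrow\psi$; ${\sim}\!\to_r$: $\Gamma\Rightarrow\phi$ and $\Gamma\Rightarrow{\sim}\chi$ / $\Gamma\Rightarrow{\sim}(\phi\to\chi)$. Modal rules: $\Box$: $\Gamma^\Box\Rightarrow\chi$ / $\Gamma\Rightarrow\Box\chi$; $\Diamond$: $\phi\Rightarrow\chi$ / $\Gamma,\Diamond\phi\Rightarrow\Diamond\chi$; $\Box_\sim$: ${\sim}\phi\Rightarrow{\sim}\chi$ / $\Gamma,{\sim}\Box\phi\Rightarrow{\sim}\Box\chi$; $\Diamond_\sim$: $\Gamma^\Diamond_\sim\Rightarrow{\sim}\chi$ / $\Gamma\Rightarrow{\sim}\Diamond\chi$; $\Diamond^\pm$: $\Gamma^\Box,\phi\Rightarrow\chi$ / $\Gamma,\Diamond\phi\Rightarrow\Diamond\chi$; $\Box^\pm_\sim$: $\Gamma^\Diamond_\sim,{\sim}\phi\Rightarrow{\sim}\chi$ / $\Gamma,{\sim}\Box\phi\Rightarrow{\sim}\Box\chi$; $\Diamond^\curlyvee$: $\Gamma^\Diamond_\sim,\phi\Rightarrow\chi$ / $\Gamma,\Diamond\phi\Rightarrow\Diamond\chi$;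 $\Box^\curlyvee_\sim$: $\Gamma^\Box,{\sim}\phi\Rightarrow{\sim}\chi$ / $\Gamma,{\sim}\Box\phi\Rightarrow{\sim}\Box\chi$; $\Box^{\Join}$: $\Gamma^\Box,\Gamma^\Diamond_\sim\Rightarrow\chi$ / $\Gamma\Rightarrow\Box\chi$; $\Diamond^{\Join}$: ${\sim}\phi\Rightarrow\chi$ / $\Gamma,{\sim}\Box\phi\Rightarrow\Diamond\chi$; $\Box^{\Join}_\sim$: $\phi\Rightarrow{\sim}\chi$ / $\Gamma,\Diamond\phi\Rightarrow{\sim}\Box\chi$; $\Diamond^{\Join}_\sim$: $\Gamma^\Box,\Gamma^\Diamond_\sim\Rightarrow{\sim}\chi$ / $\Gamma\Rightarrow{\sim}\Diamond\chi$; $\Diamond^1$: $\Gamma^\Box,\Gamma^\Diamond_\sim,\phi\Rightarrow\chi$ / $\Gamma,\Diamond\phi\Rightarrow\Diamond\chi$; $\Box^1_\sim$: $\Gamma^\Box,\Gamma^\Diamond_\sim,{\sim}\phi\Rightarrow{\sim}\chi$ / $\Gamma,{\sim}\Box\phi\Rightarrow{\sim}\Box\chi$; $\Diamond^{1,\Join}$: $\Gamma^\Box,\Gamma^\Diamond_\sim,{\sim}\phi\Rightarrow\chi$ / $\Gamma,{\sim}\Box\phi\Rightarrow\Diamond\chi$; $\Box^{1,\Join}_\sim$: $\Gamma^\Box,\Gamma^\Diamond_\sim,\phi\Rightarrow{\sim}\chi$ / $\Gamma,\Diamond\phi\Rightarrow{\sim}\Box\chi$. Calculi: $\mathcal{G}\mathsf{CN4K}=\mathcal{G}\mathsf{N4}+\{\Box,\Diamond,\Box_\sim,\Diamond_\sim\}$;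 $\mathcal{G}\mathsf{CN4K}^\curlyvee=\mathcal{G}\mathsf{N4}+\{\Box,\Diamond^\curlyvee,\Box^\curlyvee_\sim,\Diamond_\sim\}$; $\mathcal{G}\mathsf{CN4K}^\pm=\mathcal{G}\mathsf{N4}+\{\Box,\Diamond^\pm,\Box^\pm_\sim,\Diamond_\sim\}$; $\mathcal{G}\mathsf{CN4K}^{\Join}=\mathcal{G}\mathsf{N4}+\{\Box^{\Join},\Diamond,\Diamond^{\Join},\Box_\sim,\Box^{\Join}_\sim,\Diamond^{\Join}_\sim\}$; $\mathcal{G}\mathsf{CN4K}^1=\mathcal{G}\mathsf{N4}+\{\Box^{\Join},\Diamond^1,\Diamond^{1,\Join},\Box^1_\sim,\Box^{1,\Join}_\sim,\Diamond^{\Join}_\sim\}$. A proof is a finite tree of sequents, each node obtained from its children by a rule, whose leaves are axioms. -}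

module Defs where

open import Data.List.Base using (List; []; _∷_; [_]; _++_; mapMaybe)
open import Data.List.Membership.Propositional using (_∈_)
open import Data.List.Relation.Binary.Permutation.Propositional using (_↭_)
open import Data.List.Relation.Unary.All using (All)
open import Data.Maybe.Base using (Maybe; just; nothing)

infix  9 ∼_ □_ ◇_
infixr 8 _∧_
infixr 7 _∨_
infixr 6 _⊃_
infix  4 _⇒_
infix  10 _^□ _^◇∼

data Language : Set where
  modality-free modal : Language

-- `_⊃_` is the implication φ → χ of the object language.
data Formula (Atom : Set) : Language → Set where
  var         : ∀ {ℓ} → Atom → Formula Atom ℓ
  ∼_          : ∀ {ℓ} → Formula Atom ℓ → Formula Atom ℓ
  _∧_ _∨_ _⊃_ : ∀ {ℓ} → Formula Atom ℓ → Formula Atom ℓ → Formula Atom ℓ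
  □_ ◇_       : Formula Atom modal → Formula Atom modal

-- Finite multisets are represented by lists; they are identified up to
-- permutation in the constructor `node` of `Proof` below.
record Sequent (Atom : Set) (ℓ : Language) : Set where
  constructor _⇒_
  field
    antecedent : List (Formula Atom ℓ)
    succedent  : Formula Atom ℓ

□-body : ∀ {Atom ℓ} → Formula Atom ℓ → Maybe (Formula Atom ℓ)
□-body (□ φ) = just φ
□-body _     = nothing

∼◇-body : ∀ {Atom ℓ} → Formula Atom ℓ → Maybe (Formula Atom ℓ)
∼◇-body (∼ (◇ φ)) = just (∼ φ)
∼◇-body _         = nothing

_^□ : ∀ {Atom ℓ} → List (Formula Atom ℓ) → List (Formula Atom ℓ)
Γ ^□ = mapMaybe □-body Γ

_^◇∼ : ∀ {Atom ℓ} → List (Formula Atom ℓ) → List (Formula Atom ℓ)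
Γ ^◇∼ = mapMaybe ∼◇-body Γ

-- A rule relates the list of its premises to its conclusion.
RuleSchema : Set → Language → Set₁
RuleSchema Atom ℓ = List (Sequent Atom ℓ) → Sequent Atom ℓ → Set

data N4Rule {Atom : Set} {ℓ : Language} : RuleSchema Atom ℓ where
  ax   : ∀ {Γ p} → N4Rule [] (var p ∷ Γ ⇒ var p)
  ∼ax  : ∀ {Γ p} → N4Rule [] (∼ var p ∷ Γ ⇒ ∼ var p)
  ∼∼ₗ  : ∀ {Γ φ ψ} → N4Rule [ φ ∷ Γ ⇒ ψ ] (∼ (∼ φ) ∷ Γ ⇒ ψ)
  ∼∼ᵣ  : ∀ {Γ φ} → N4Rule [ Γ ⇒ φ ] (Γ ⇒ ∼ (∼ φ))
  ∧ₗ   : ∀ {Γ φ χ ψ} → N4Rule [ φ ∷ χ ∷ Γ ⇒ ψ ] (φ ∧ χ ∷ Γ ⇒ ψ)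
  ∧ᵣ   : ∀ {Γ φ χ} → N4Rule ((Γ ⇒ φ) ∷ (Γ ⇒ χ) ∷ []) (Γ ⇒ φ ∧ χ)
  ∨ₗ   : ∀ {Γ φ χ ψ} →
         N4Rule ((φ ∷ Γ ⇒ ψ) ∷ (χ ∷ Γ ⇒ ψ) ∷ []) (φ ∨ χ ∷ Γ ⇒ ψ)
  ∨ᵣ₁  : ∀ {Γ φ χ} → N4Rule [ Γ ⇒ φ ] (Γ ⇒ φ ∨ χ)
  ∨ᵣ₂  : ∀ {Γ φ χ} → N4Rule [ Γ ⇒ χ ] (Γ ⇒ φ ∨ χ)
  ∼∨ₗ  : ∀ {Γ φ χ ψ} → N4Rule [ ∼ φ ∷ ∼ χ ∷ Γ ⇒ ψ ] (∼ (φ ∨ χ) ∷ Γ ⇒ ψ)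
  ∼∨ᵣ  : ∀ {Γ φ χ} → N4Rule ((Γ ⇒ ∼ φ) ∷ (Γ ⇒ ∼ χ) ∷ []) (Γ ⇒ ∼ (φ ∨ χ))
  ∼∧ₗ  : ∀ {Γ φ χ ψ} →
         N4Rule ((∼ φ ∷ Γ ⇒ ψ) ∷ (∼ χ ∷ Γ ⇒ ψ) ∷ []) (∼ (φ ∧ χ) ∷ Γ ⇒ ψ)
  ∼∧ᵣ₁ : ∀ {Γ φ χ} → N4Rule [ Γ ⇒ ∼ φ ] (Γ ⇒ ∼ (φ ∧ χ))
  ∼∧ᵣ₂ : ∀ {Γ φ χ} → N4Rule [ Γ ⇒ ∼ χ ] (Γ ⇒ ∼ (φ ∧ χ))
  ⊃ₗ   : ∀ {Γ φ χ ψ} →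
         N4Rule ((φ ⊃ χ ∷ Γ ⇒ φ) ∷ (χ ∷ Γ ⇒ ψ) ∷ []) (φ ⊃ χ ∷ Γ ⇒ ψ)
  ⊃ᵣ   : ∀ {Γ φ χ} → N4Rule [ φ ∷ Γ ⇒ χ ] (Γ ⇒ φ ⊃ χ)
  ∼⊃ₗ  : ∀ {Γ φ χ ψ} → N4Rule [ φ ∷ ∼ χ ∷ Γ ⇒ ψ ] (∼ (φ ⊃ χ) ∷ Γ ⇒ ψ)
  ∼⊃ᵣ  : ∀ {Γ φ χ} → N4Rule ((Γ ⇒ φ) ∷ (Γ ⇒ ∼ χ) ∷ []) (Γ ⇒ ∼ (φ ⊃ χ))

data ModalRuleName : Set where
  R□ R◇ R□∼ R◇∼ R◇± R□∼± R◇⋎ R□∼⋎ R□⋈ R◇⋈ R□∼⋈ R◇∼⋈ R◇¹ R□∼¹ R◇¹⋈ R□∼¹⋈ :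
    ModalRuleName

data ModalRule {Atom : Set} :
       ∀ {ℓ} → ModalRuleName → RuleSchema Atom ℓ where
  □-rule    : ∀ {Γ χ} → ModalRule R□ [ Γ ^□ ⇒ χ ] (Γ ⇒ □ χ)
  ◇-rule    : ∀ {Γ φ χ} → ModalRule R◇ [ [ φ ] ⇒ χ ] (◇ φ ∷ Γ ⇒ ◇ χ)
  □∼-rule   : ∀ {Γ φ χ} →
              ModalRule R□∼ [ [ ∼ φ ] ⇒ ∼ χ ] (∼ (□ φ) ∷ Γ ⇒ ∼ (□ χ))
  ◇∼-rule   : ∀ {Γ χ} → ModalRule R◇∼ [ Γ ^◇∼ ⇒ ∼ χ ] (Γ ⇒ ∼ (◇ χ))
  ◇±-rule   : ∀ {Γ φ χ} →
              ModalRule R◇± [ φ ∷ Γ ^□ ⇒ χ ] (◇ φ ∷ Γ ⇒ ◇ χ)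
  □∼±-rule  : ∀ {Γ φ χ} →
              ModalRule R□∼± [ ∼ φ ∷ Γ ^◇∼ ⇒ ∼ χ ] (∼ (□ φ) ∷ Γ ⇒ ∼ (□ χ))
  ◇⋎-rule   : ∀ {Γ φ χ} →
              ModalRule R◇⋎ [ φ ∷ Γ ^◇∼ ⇒ χ ] (◇ φ ∷ Γ ⇒ ◇ χ)
  □∼⋎-rule  : ∀ {Γ φ χ} →
              ModalRule R□∼⋎ [ ∼ φ ∷ Γ ^□ ⇒ ∼ χ ] (∼ (□ φ) ∷ Γ ⇒ ∼ (□ χ))
  □⋈-rule   : ∀ {Γ χ} → ModalRule R□⋈ [ Γ ^□ ++ Γ ^◇∼ ⇒ χ ] (Γ ⇒ □ χ)
  ◇⋈-rule   : ∀ {Γ φ χ} →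
              ModalRule R◇⋈ [ [ ∼ φ ] ⇒ χ ] (∼ (□ φ) ∷ Γ ⇒ ◇ χ)
  □∼⋈-rule  : ∀ {Γ φ χ} →
              ModalRule R□∼⋈ [ [ φ ] ⇒ ∼ χ ] (◇ φ ∷ Γ ⇒ ∼ (□ χ))
  ◇∼⋈-rule  : ∀ {Γ χ} →
              ModalRule R◇∼⋈ [ Γ ^□ ++ Γ ^◇∼ ⇒ ∼ χ ] (Γ ⇒ ∼ (◇ χ))
  ◇¹-rule   : ∀ {Γ φ χ} →
              ModalRule R◇¹ [ φ ∷ Γ ^□ ++ Γ ^◇∼ ⇒ χ ] (◇ φ ∷ Γ ⇒ ◇ χ)
  □∼¹-rule  : ∀ {Γ φ χ} →
              ModalRule R□∼¹ [ ∼ φ ∷ Γ ^□ ++ Γ ^◇∼ ⇒ ∼ χ ]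
                             (∼ (□ φ) ∷ Γ ⇒ ∼ (□ χ))
  ◇¹⋈-rule  : ∀ {Γ φ χ} →
              ModalRule R◇¹⋈ [ ∼ φ ∷ Γ ^□ ++ Γ ^◇∼ ⇒ χ ] (∼ (□ φ) ∷ Γ ⇒ ◇ χ)
  □∼¹⋈-rule : ∀ {Γ φ χ} →
              ModalRule R□∼¹⋈ [ φ ∷ Γ ^□ ++ Γ ^◇∼ ⇒ ∼ χ ]
                              (◇ φ ∷ Γ ⇒ ∼ (□ χ))

data Calculus : Set where
  GN4 GCN4K GCN4K± GCN4K⋎ GCN4K⋈ GCN4K¹ : Calculus

language : Calculus → Language
language GN4 = modality-free
language _   = modal

modalRules : Calculus → List ModalRuleName
modalRules GN4    = []
modalRules GCN4K  = R□ ∷ R◇ ∷ R□∼ ∷ R◇∼ ∷ []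
modalRules GCN4K± = R□ ∷ R◇± ∷ R□∼± ∷ R◇∼ ∷ []
modalRules GCN4K⋎ = R□ ∷ R◇⋎ ∷ R□∼⋎ ∷ R◇∼ ∷ []
modalRules GCN4K⋈ = R□⋈ ∷ R◇ ∷ R◇⋈ ∷ R□∼ ∷ R□∼⋈ ∷ R◇∼⋈ ∷ []
modalRules GCN4K¹ = R□⋈ ∷ R◇¹ ∷ R◇¹⋈ ∷ R□∼¹ ∷ R□∼¹⋈ ∷ R◇∼⋈ ∷ []

data Rule {Atom : Set} (L : Calculus) : RuleSchema Atom (language L) where
  n4    : ∀ {Ss S} → N4Rule Ss S → Rule L Ss S
  modal : ∀ {r Ss S} → r ∈ modalRules L → ModalRule r Ss S → Rule L Ss S

-- The permutation expresses that Γ and Γ′ are the same multiset; axioms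
-- are the rules without premises.
data Proof {Atom : Set} (L : Calculus) :
       Sequent Atom (language L) → Set where
  node : ∀ {Ss Γ Γ′ φ} →
         Rule L Ss (Γ′ ⇒ φ) → Γ ↭ Γ′ → All (Proof L) Ss →
         Proof L (Γ ⇒ φ)

Admissible : ∀ {Atom} (L : Calculus) → RuleSchema Atom (language L) → Set
Admissible L R = ∀ {Ss S} → R Ss S → All (Proof L) Ss → Proof L S

data Cut {Atom : Set} {ℓ : Language} : RuleSchema Atom ℓ where
  cut : ∀ {Γ Δ φ χ} →
        Cut ((Γ ⇒ φ) ∷ (φ ∷ Δ ⇒ χ) ∷ []) (Γ ++ Δ ⇒ χ)

{-# OPTIONS --safe #-}
module Submission where

-- Up to the sign of its outermost connective every formula behaves like a
-- literal, a conjunction, a disjunction, an implication, a box or a diamond: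
-- ∼ (φ ∧ χ) is a disjunction of ∼ φ and ∼ χ, ∼ (◇ φ) a box over ∼ φ, and so on.
-- In these terms the six calculi differ only in which boxes their modal rules
-- keep in the premise and in which signs of diamonds may be matched.  Cut is
-- eliminated, by induction on the cut formula and the two derivations, for a
-- variant of the calculus whose antecedents are sets and whose left rules keep
-- their principal formula, so that weakening and contraction are free.  A set
-- derivation of Γ ⇒ ψ yields a multiset derivation of Δ ⇒ ψ whenever each member
-- of Γ is in Δ or already decomposed in Δ by left rules; this one induction
-- replaces the usual inversion and contraction lemmas.

open import Defs
open import Data.Empty using (⊥)
open import Data.List.Base using (List; []; _∷_; _++_; mapMaybe)
open import Data.List.Membership.Propositional using (_∈_)
open import Data.List.Membership.Propositional.Properties using (∈-∃++; ∈-++⁺ˡ; ∈-++⁺ʳ; ∈-++⁻)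
open import Data.List.Relation.Binary.Permutation.Propositional using (_↭_; ↭-refl; ↭-sym)
open import Data.List.Relation.Binary.Permutation.Propositional.Properties using (shift)
open import Data.List.Relation.Binary.Subset.Propositional using (_⊆_)
open import Data.List.Relation.Binary.Subset.Propositional.Properties
  using (∷⁺ʳ; ∈-∷⁺ʳ; ++⁺ʳ; xs⊆ys++xs; ⊆-reflexive-↭)
open import Data.List.Relation.Unary.All using (All; []; _∷_)
open import Data.List.Relation.Unary.Any using (here; there)
open import Data.Maybe.Base using (Maybe; just; nothing)
open import Data.Nat.Base using (ℕ)
open import Data.Product.Base using (∃; _×_; _,_; proj₁)
open import Data.Sum.Base using (_⊎_; inj₁; inj₂)
open import Data.Unit.Base using (⊤; tt)
open import Function.Base using (id; _∘_)
open import Function.Bundles using (_↣_)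
open import Relation.Binary.PropositionalEquality using (_≡_; refl)

infix 4 _▹_ _sees_
infix 10 _↾_

-- Signed shapes of formulas

data Polarity : Set where
  pos neg : Polarity

opposite : Polarity → Polarity
opposite pos = neg
opposite neg = pos

-- Only boxes and diamonds carry a sign, because the modal rules of some calculi separate `□ φ` from
-- `∼ (◇ φ)` and `◇ φ` from `∼ (□ φ)`.
data Shape (F : Set) : Set where
  lit            : Shape F
  conj disj impl : F → F → Shape F
  box dia        : Polarity → F → Shape F

parts : ∀ {F} → Shape F → List F
parts lit        = []
parts (conj A B) = A ∷ B ∷ []
parts (disj A B) = A ∷ B ∷ []
parts (impl A B) = A ∷ B ∷ []
parts (box _ A)  = A ∷ []
parts (dia _ A)  = A ∷ []

-- A double negation counts as the conjunction of φ with itself.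
data _▹_ {Atom : Set} : ∀ {ℓ} → Formula Atom ℓ → Shape (Formula Atom ℓ) → Set where
  var  : ∀ {ℓ p} → var {ℓ = ℓ} p ▹ lit
  ∼var : ∀ {ℓ p} → ∼ var {ℓ = ℓ} p ▹ lit
  ∼∼   : ∀ {ℓ} {φ : Formula Atom ℓ} → ∼ (∼ φ) ▹ conj φ φ
  ∧▹   : ∀ {ℓ} {φ χ : Formula Atom ℓ} → φ ∧ χ ▹ conj φ χ
  ∼∨   : ∀ {ℓ} {φ χ : Formula Atom ℓ} → ∼ (φ ∨ χ) ▹ conj (∼ φ) (∼ χ)
  ∼⊃   : ∀ {ℓ} {φ χ : Formula Atom ℓ} → ∼ (φ ⊃ χ) ▹ conj φ (∼ χ)
  ∨▹   : ∀ {ℓ} {φ χ : Formula Atom ℓ} → φ ∨ χ ▹ disj φ χ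
  ∼∧   : ∀ {ℓ} {φ χ : Formula Atom ℓ} → ∼ (φ ∧ χ) ▹ disj (∼ φ) (∼ χ)
  ⊃▹   : ∀ {ℓ} {φ χ : Formula Atom ℓ} → φ ⊃ χ ▹ impl φ χ
  □▹   : ∀ {φ : Formula Atom modal} → □ φ ▹ box pos φ
  ∼◇   : ∀ {φ : Formula Atom modal} → ∼ (◇ φ) ▹ box neg (∼ φ)
  ◇▹   : ∀ {φ : Formula Atom modal} → ◇ φ ▹ dia pos φ
  ∼□   : ∀ {φ : Formula Atom modal} → ∼ (□ φ) ▹ dia neg (∼ φ)

▹-functional : ∀ {Atom ℓ} {φ : Formula Atom ℓ} {s t} → φ ▹ s → φ ▹ t → s ≡ t
▹-functional var  var  = refl
▹-functional ∼var ∼var = refl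
▹-functional ∼∼   ∼∼   = refl
▹-functional ∧▹   ∧▹   = refl
▹-functional ∼∨   ∼∨   = refl
▹-functional ∼⊃   ∼⊃   = refl
▹-functional ∨▹   ∨▹   = refl
▹-functional ∼∧   ∼∧   = refl
▹-functional ⊃▹   ⊃▹   = refl
▹-functional □▹   □▹   = refl
▹-functional ∼◇   ∼◇   = refl
▹-functional ◇▹   ◇▹   = refl
▹-functional ∼□   ∼□   = refl

-- A part of a negated formula can be the negation of a subformula and so escape structural
-- recursion; treating `φ` and `∼ φ` together repairs this.
▹-induction : ∀ {Atom ℓ} {P : Formula Atom ℓ → Set} →
              (∀ {φ s} → φ ▹ s → All P (parts s) → P φ) → ∀ φ → P φ
▹-induction {P = P} step = proj₁ ∘ both-signs
  where
  both-signs : ∀ φ → P φ × P (∼ φ)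
  both-signs (var p) = step var [] , step ∼var []
  both-signs (∼ φ) with both-signs φ
  ... | x , ∼x = ∼x , step ∼∼ (x ∷ x ∷ [])
  both-signs (φ ∧ χ) with both-signs φ | both-signs χ
  ... | x , ∼x | y , ∼y = step ∧▹ (x ∷ y ∷ []) , step ∼∧ (∼x ∷ ∼y ∷ [])
  both-signs (φ ∨ χ) with both-signs φ | both-signs χ
  ... | x , ∼x | y , ∼y = step ∨▹ (x ∷ y ∷ []) , step ∼∨ (∼x ∷ ∼y ∷ [])
  both-signs (φ ⊃ χ) with both-signs φ | both-signs χ
  ... | x , ∼x | y , ∼y = step ⊃▹ (x ∷ y ∷ []) , step ∼⊃ (x ∷ ∼y ∷ [])
  both-signs (□ φ) with both-signs φ
  ... | x , ∼x = step □▹ (x ∷ []) , step ∼□ (∼x ∷ [])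
  both-signs (◇ φ) with both-signs φ
  ... | x , ∼x = step ◇▹ (x ∷ []) , step ∼◇ (∼x ∷ [])

-- Restriction of antecedents to box bodies

-- The signs of the boxes whose bodies a modal rule keeps in its premise.
data Scope : Set where
  none both : Scope
  only      : Polarity → Scope

data _sees_ : Scope → Polarity → Set where
  only : ∀ {p} → only p sees p
  both : ∀ {p} → both sees p

sees? : ∀ c p → (c sees p) ⊎ (c sees p → ⊥)
sees? none     p = inj₂ λ ()
sees? both     p = inj₁ both
sees? (only pos) pos = inj₁ only
sees? (only pos) neg = inj₂ λ ()
sees? (only neg) pos = inj₂ λ ()
sees? (only neg) neg = inj₁ only

_↾_ : ∀ {Atom ℓ} → List (Formula Atom ℓ) → Scope → List (Formula Atom ℓ)
Γ ↾ none   = []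
Γ ↾ only pos = Γ ^□
Γ ↾ only neg = Γ ^◇∼
Γ ↾ both   = Γ ^□ ++ Γ ^◇∼

∈-mapMaybe⁻ : ∀ {A B : Set} (f : A → Maybe B) xs {y} →
              y ∈ mapMaybe f xs → ∃ λ x → x ∈ xs × f x ≡ just y
∈-mapMaybe⁻ f (x ∷ xs) i with f x in eq
∈-mapMaybe⁻ f (x ∷ xs) (here refl) | just _ = x , here refl , eq
∈-mapMaybe⁻ f (x ∷ xs) (there i) | just _ =
  let z , j , e = ∈-mapMaybe⁻ f xs i in z , there j , e
∈-mapMaybe⁻ f (x ∷ xs) i | nothing =
  let z , j , e = ∈-mapMaybe⁻ f xs i in z , there j , e

∈-mapMaybe⁺ : ∀ {A B : Set} (f : A → Maybe B) {x xs y} →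
              x ∈ xs → f x ≡ just y → y ∈ mapMaybe f xs
∈-mapMaybe⁺ f (here refl) e rewrite e = here refl
∈-mapMaybe⁺ f {xs = x ∷ _} (there i) e with f x
... | just _  = there (∈-mapMaybe⁺ f i e)
... | nothing = ∈-mapMaybe⁺ f i e

□-body⁻ : ∀ {Atom ℓ} (φ : Formula Atom ℓ) {A} → □-body φ ≡ just A → φ ▹ box pos A
□-body⁻ (□ φ) refl = □▹

∼◇-body⁻ : ∀ {Atom ℓ} (φ : Formula Atom ℓ) {A} → ∼◇-body φ ≡ just A → φ ▹ box neg A
∼◇-body⁻ (∼ (◇ φ)) refl = ∼◇

module _ {Atom : Set} {ℓ : Language} where

  private F = Formula Atom ℓ

  infix 4 _∈box[_,_]

  _∈box[_,_] : F → Polarity → List F → Set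
  A ∈box[ p , Γ ] = ∃ λ φ → φ ∈ Γ × φ ▹ box p A

  ∈-^□⁻ : ∀ Γ {A} → A ∈ Γ ^□ → A ∈box[ pos , Γ ]
  ∈-^□⁻ Γ i = let φ , j , e = ∈-mapMaybe⁻ □-body Γ i in φ , j , □-body⁻ φ e

  ∈-^◇∼⁻ : ∀ Γ {A} → A ∈ Γ ^◇∼ → A ∈box[ neg , Γ ]
  ∈-^◇∼⁻ Γ i = let φ , j , e = ∈-mapMaybe⁻ ∼◇-body Γ i in φ , j , ∼◇-body⁻ φ e

  ∈-^□⁺ : ∀ {Γ A} → A ∈box[ pos , Γ ] → A ∈ Γ ^□
  ∈-^□⁺ (_ , i , □▹) = ∈-mapMaybe⁺ □-body i refl

  ∈-^◇∼⁺ : ∀ {Γ A} → A ∈box[ neg , Γ ] → A ∈ Γ ^◇∼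
  ∈-^◇∼⁺ (_ , i , ∼◇) = ∈-mapMaybe⁺ ∼◇-body i refl

  ∈-↾⁻ : ∀ c Γ {A} → A ∈ Γ ↾ c → ∃ λ p → c sees p × A ∈box[ p , Γ ]
  ∈-↾⁻ (only pos) Γ i = pos , only , ∈-^□⁻ Γ i
  ∈-↾⁻ (only neg) Γ i = neg , only , ∈-^◇∼⁻ Γ i
  ∈-↾⁻ both Γ i with ∈-++⁻ (Γ ^□) i
  ... | inj₁ j = pos , both , ∈-^□⁻ Γ j
  ... | inj₂ j = neg , both , ∈-^◇∼⁻ Γ j

  ∈-↾⁺ : ∀ {c p} Γ {A} → c sees p → A ∈box[ p , Γ ] → A ∈ Γ ↾ c
  ∈-↾⁺ {p = pos} Γ only b = ∈-^□⁺ b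
  ∈-↾⁺ {p = neg} Γ only b = ∈-^◇∼⁺ b
  ∈-↾⁺ {p = pos} Γ both b = ∈-++⁺ˡ (∈-^□⁺ b)
  ∈-↾⁺ {p = neg} Γ both b = ∈-++⁺ʳ (Γ ^□) (∈-^◇∼⁺ b)

  ↾-mono : ∀ c d {Γ Δ : List F} → (∀ {p} → c sees p → d sees p) → Γ ⊆ Δ → Γ ↾ c ⊆ Δ ↾ d
  ↾-mono c d {Γ} {Δ} c≤d Γ⊆Δ i with ∈-↾⁻ c Γ i
  ... | p , v , φ , j , e = ∈-↾⁺ Δ (c≤d v) (φ , Γ⊆Δ j , e)

  ↾-⊆ : ∀ c {Γ Δ : List F} → Γ ⊆ Δ → Γ ↾ c ⊆ Δ ↾ c
  ↾-⊆ c = ↾-mono c c id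

  -- Serves two situations at once: `φ` is no box, or it is a box whose sign lies outside the scope.
  -- Either way it contributes nothing to the restriction.
  ↾-⊆-unseen : ∀ c {φ s} {Ξ Δ : List F} → φ ▹ s → (∀ {p A} → s ≡ box p A → c sees p → ⊥) →
               Ξ ⊆ φ ∷ Δ → Ξ ↾ c ⊆ Δ ↾ c
  ↾-⊆-unseen c {Ξ = Ξ} {Δ} e unseen Ξ⊆ i with ∈-↾⁻ c Ξ i
  ... | p , v , φ , j , e′ with Ξ⊆ j
  ...   | there k = ∈-↾⁺ Δ v (φ , k , e′)
  ...   | here refl with () ← unseen (▹-functional e e′) v

  ↾-⊆-seen : ∀ c {φ p A} {Ξ Δ : List F} → φ ▹ box p A → Ξ ⊆ φ ∷ Δ → Ξ ↾ c ⊆ A ∷ Δ ↾ c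
  ↾-⊆-seen c {Ξ = Ξ} {Δ} e Ξ⊆ i with ∈-↾⁻ c Ξ i
  ... | p , v , φ , j , e′ with Ξ⊆ j
  ...   | there k = there (∈-↾⁺ Δ v (φ , k , e′))
  ...   | here refl with refl ← ▹-functional e e′ = here refl

-- The six calculi as parameters

boxScope : Calculus → Polarity → Scope
boxScope GCN4K⋈ _ = both
boxScope GCN4K¹ _ = both
boxScope _      p = only p

diaScope : Calculus → Polarity → Scope
diaScope GCN4K± p = only p
diaScope GCN4K⋎ p = only (opposite p)
diaScope GCN4K¹ _ = both
diaScope _      _ = none

-- L has a rule with a principal antecedent of shape `dia p` and a succedent of
-- shape `dia q`.
Linked : Calculus → Polarity → Polarity → Set
Linked GN4    _ _ = ⊥
Linked GCN4K⋈ _ _ = ⊤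
Linked GCN4K¹ _ _ = ⊤
Linked _      p q = p ≡ q

-- Needed when a box is cut against a modal rule: the premise of the box rule
-- must fit into the premise of the other rule.
Closed : Calculus → Scope → Set
Closed L c = ∀ {q r} → c sees q → boxScope L q sees r → c sees r

closed-boxScope : ∀ L p → Closed L (boxScope L p)
closed-boxScope GN4    p only only = only
closed-boxScope GCN4K  p only only = only
closed-boxScope GCN4K± p only only = only
closed-boxScope GCN4K⋎ p only only = only
closed-boxScope GCN4K⋈ p _    _    = both
closed-boxScope GCN4K¹ p _    _    = both

closed-diaScope : ∀ L p → Closed L (diaScope L p)
closed-diaScope GN4    p ()
closed-diaScope GCN4K  p ()
closed-diaScope GCN4K± p only only = only
closed-diaScope GCN4K⋎ p only only = only
closed-diaScope GCN4K⋈ p ()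
closed-diaScope GCN4K¹ p _    _    = both

linked-trans : ∀ L {p q r} → Linked L p q → Linked L q r → Linked L p r
linked-trans GCN4K  refl refl = refl
linked-trans GCN4K± refl refl = refl
linked-trans GCN4K⋎ refl refl = refl
linked-trans GCN4K⋈ _    _    = tt
linked-trans GCN4K¹ _    _    = tt

-- When a cut fuses two diamond rules, the result is restricted by the scope of the first; the
-- premise of the second must fit into it.
linked-sees : ∀ L {p q r} → Linked L p q → diaScope L q sees r → diaScope L p sees r
linked-sees GCN4K  refl v = v
linked-sees GCN4K± refl v = v
linked-sees GCN4K⋎ refl v = v
linked-sees GCN4K⋈ _    v = v
linked-sees GCN4K¹ _    v = v

-- The set-based calculus

module _ {Atom : Set} (L : Calculus) where

  private F = Formula Atom (language L)

  infix 4 _⊢_ _⊢ᵣ_ _⊢ₗ_,_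

  data _⊢_ : List F → F → Set
  data _⊢ᵣ_ : List F → Shape F → Set
  data _⊢ₗ_,_ : List F → Shape F → F → Set

  data _⊢_ where
    hyp   : ∀ {Γ φ} → φ ∈ Γ → φ ▹ lit → Γ ⊢ φ
    right : ∀ {Γ φ s} → φ ▹ s → Γ ⊢ᵣ s → Γ ⊢ φ
    left  : ∀ {Γ φ s ψ} → φ ∈ Γ → φ ▹ s → Γ ⊢ₗ s , ψ → Γ ⊢ ψ

  -- `dia` counts as a right rule although it has a principal antecedent: like `box` it introduces
  -- the succedent, so no left rule acts on modal shapes.
  data _⊢ᵣ_ where
    conj  : ∀ {Γ A B} → Γ ⊢ A → Γ ⊢ B → Γ ⊢ᵣ conj A B
    disj₁ : ∀ {Γ A B} → Γ ⊢ A → Γ ⊢ᵣ disj A B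
    disj₂ : ∀ {Γ A B} → Γ ⊢ B → Γ ⊢ᵣ disj A B
    impl  : ∀ {Γ A B} → A ∷ Γ ⊢ B → Γ ⊢ᵣ impl A B
    box   : ∀ {Γ p A} → Γ ↾ boxScope L p ⊢ A → Γ ⊢ᵣ box p A
    dia   : ∀ {Γ φ p q A B} → φ ∈ Γ → φ ▹ dia p A → Linked L p q →
            A ∷ Γ ↾ diaScope L p ⊢ B → Γ ⊢ᵣ dia q B

  data _⊢ₗ_,_ where
    conj : ∀ {Γ A B ψ} → A ∷ B ∷ Γ ⊢ ψ → Γ ⊢ₗ conj A B , ψ
    disj : ∀ {Γ A B ψ} → A ∷ Γ ⊢ ψ → B ∷ Γ ⊢ ψ → Γ ⊢ₗ disj A B , ψ
    impl : ∀ {Γ A B ψ} → Γ ⊢ A → B ∷ Γ ⊢ ψ → Γ ⊢ₗ impl A B , ψ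

  weaken : ∀ {Γ Δ φ} → Γ ⊆ Δ → Γ ⊢ φ → Δ ⊢ φ
  weakenᵣ : ∀ {Γ Δ s} → Γ ⊆ Δ → Γ ⊢ᵣ s → Δ ⊢ᵣ s
  weakenₗ : ∀ {Γ Δ s ψ} → Γ ⊆ Δ → Γ ⊢ₗ s , ψ → Δ ⊢ₗ s , ψ

  weaken Γ⊆Δ (hyp i e)    = hyp (Γ⊆Δ i) e
  weaken Γ⊆Δ (right e D)  = right e (weakenᵣ Γ⊆Δ D)
  weaken Γ⊆Δ (left i e D) = left (Γ⊆Δ i) e (weakenₗ Γ⊆Δ D)

  weakenᵣ Γ⊆Δ (conj D E) = conj (weaken Γ⊆Δ D) (weaken Γ⊆Δ E)
  weakenᵣ Γ⊆Δ (disj₁ D)  = disj₁ (weaken Γ⊆Δ D)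
  weakenᵣ Γ⊆Δ (disj₂ D)  = disj₂ (weaken Γ⊆Δ D)
  weakenᵣ Γ⊆Δ (impl D)   = impl (weaken (∷⁺ʳ _ Γ⊆Δ) D)
  weakenᵣ Γ⊆Δ (box {p = p} D) = box (weaken (↾-⊆ (boxScope L p) Γ⊆Δ) D)
  weakenᵣ Γ⊆Δ (dia {p = p} i e l D) =
    dia (Γ⊆Δ i) e l (weaken (∷⁺ʳ _ (↾-⊆ (diaScope L p) Γ⊆Δ)) D)

  weakenₗ Γ⊆Δ (conj D)   = conj (weaken (∷⁺ʳ _ (∷⁺ʳ _ Γ⊆Δ)) D)
  weakenₗ Γ⊆Δ (disj D E) = disj (weaken (∷⁺ʳ _ Γ⊆Δ) D) (weaken (∷⁺ʳ _ Γ⊆Δ) E)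
  weakenₗ Γ⊆Δ (impl D E) = impl (weaken Γ⊆Δ D) (weaken (∷⁺ʳ _ Γ⊆Δ) E)

  -- Cut elimination for set derivations

  lit-underivable : ∀ {Γ φ s} → φ ▹ lit → φ ▹ s → Γ ⊢ᵣ s → ⊥
  lit-underivable e f D with refl ← ▹-functional e f with () ← D

  -- The two inclusions keep the derivations themselves unweakened, so that
  -- the recursion on them is structural.
  CutOn : F → Set
  CutOn φ = ∀ {Γ Ξ Δ ψ} → Γ ⊢ φ → Ξ ⊢ ψ → Γ ⊆ Δ → Ξ ⊆ φ ∷ Δ → Δ ⊢ ψ

  cut-⊢ : ∀ {φ Δ ψ} → CutOn φ → Δ ⊢ φ → φ ∷ Δ ⊢ ψ → Δ ⊢ ψ
  cut-⊢ c D E = c D E id id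

  ∷-under : ∀ {φ A : F} {Ξ Δ} → Ξ ⊆ φ ∷ Δ → A ∷ Ξ ⊆ φ ∷ A ∷ Δ
  ∷-under Ξ⊆ (here refl) = there (here refl)
  ∷-under Ξ⊆ (there i) with Ξ⊆ i
  ... | here refl = here refl
  ... | there j   = there (there j)

  weaken-unseen : ∀ Θ c {φ s Ξ Δ ψ} → φ ▹ s → (∀ {p A} → s ≡ box p A → c sees p → ⊥) →
                  Ξ ⊆ φ ∷ Δ → Θ ++ Ξ ↾ c ⊢ ψ → Θ ++ Δ ↾ c ⊢ ψ
  weaken-unseen Θ c e u Ξ⊆ = weaken (++⁺ʳ Θ (↾-⊆-unseen c e u Ξ⊆))

  -- A cut formula that does not enter the modal premise simply disappears. A box that enters it is
  -- traded for a cut on its body, and closedness makes the antecedent of the box premise fit.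
  cut-scope : ∀ Θ c {φ s Γ Ξ Δ ψ} → Closed L c → φ ▹ s → All CutOn (parts s) → Γ ⊢ᵣ s →
              Γ ⊆ Δ → Ξ ⊆ φ ∷ Δ → Θ ++ Ξ ↾ c ⊢ ψ → Θ ++ Δ ↾ c ⊢ ψ
  cut-scope Θ c _ e _ (conj _ _)    _ = weaken-unseen Θ c e (λ ())
  cut-scope Θ c _ e _ (disj₁ _)     _ = weaken-unseen Θ c e (λ ())
  cut-scope Θ c _ e _ (disj₂ _)     _ = weaken-unseen Θ c e (λ ())
  cut-scope Θ c _ e _ (impl _)      _ = weaken-unseen Θ c e (λ ())
  cut-scope Θ c _ e _ (dia _ _ _ _) _ = weaken-unseen Θ c e (λ ())
  cut-scope Θ c closed e (cutA ∷ []) (box {p = p} D) Γ⊆Δ Ξ⊆ E with sees? c p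
  ... | inj₁ v = cutA D E (xs⊆ys++xs _ Θ ∘ ↾-mono (boxScope L p) c (closed v) Γ⊆Δ)
                   (⊆-reflexive-↭ (shift _ Θ _) ∘ ++⁺ʳ Θ (↾-⊆-seen c e Ξ⊆))
  ... | inj₂ u = weaken-unseen Θ c e (λ { refl → u }) Ξ⊆ E

  -- Two diamond rules meeting at the cut formula fuse into one, from the antecedent diamond of the
  -- first to the succedent of the second, after a cut on the body.
  cut-dia : ∀ {φ Γ Ξ Δ p q A B} → φ ▹ dia p A → All CutOn (parts (dia p A)) → Γ ⊢ᵣ dia p A →
            Γ ⊆ Δ → Ξ ⊆ φ ∷ Δ → Linked L p q → A ∷ Ξ ↾ diaScope L p ⊢ B → Δ ⊢ᵣ dia q B
  cut-dia {p = p} f (cutA ∷ []) (dia {p = r} i g k D) Γ⊆Δ Ξ⊆ l E =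
    dia (Γ⊆Δ i) g (linked-trans L k l)
      (cutA D E (∷⁺ʳ _ (↾-⊆ (diaScope L r) Γ⊆Δ))
        (∷⁺ʳ _ (there ∘ ↾-mono (diaScope L p) (diaScope L r) (linked-sees L k) id
                      ∘ ↾-⊆-unseen (diaScope L p) f (λ ()) Ξ⊆)))

  cut-principal : ∀ {t Δ ψ} → All CutOn (parts t) → Δ ⊢ᵣ t → Δ ⊢ₗ t , ψ → Δ ⊢ ψ
  cut-principal (cutA ∷ cutB ∷ []) (conj D D′) (conj E) =
    cut-⊢ cutB D′ (cutA D E there id)
  cut-principal (cutA ∷ _) (disj₁ D) (disj E _) = cut-⊢ cutA D E
  cut-principal (_ ∷ cutB ∷ []) (disj₂ D) (disj _ E) = cut-⊢ cutB D E
  cut-principal (cutA ∷ cutB ∷ []) (impl D) (impl E E′) = cut-⊢ cutB (cut-⊢ cutA E D) E′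

  module _ {φ : F} {s : Shape F} (e : φ ▹ s) (cuts : All CutOn (parts s)) where

    module _ {Γ : List F} (D : Γ ⊢ᵣ s) where

      -- Recursion on the derivation that uses the cut formula; `D` and its antecedent stay fixed
      -- while the inclusions grow.
      cut-right : ∀ {Ξ Δ ψ} → Ξ ⊢ ψ → Γ ⊆ Δ → Ξ ⊆ φ ∷ Δ → Δ ⊢ ψ
      cut-rightᵣ : ∀ {Ξ Δ t} → Ξ ⊢ᵣ t → Γ ⊆ Δ → Ξ ⊆ φ ∷ Δ → Δ ⊢ᵣ t
      cut-rightₗ : ∀ {Ξ Δ t ψ} → Ξ ⊢ₗ t , ψ → Γ ⊆ Δ → Ξ ⊆ φ ∷ Δ → Δ ⊢ₗ t , ψ

      cut-right (right f E) Γ⊆Δ Ξ⊆ = right f (cut-rightᵣ E Γ⊆Δ Ξ⊆)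
      cut-right (hyp i f) Γ⊆Δ Ξ⊆ with Ξ⊆ i
      ... | there j = hyp j f
      -- No right rule derives a literal, so the axiom cannot be on the cut formula.
      ... | here refl with () ← lit-underivable f e D
      cut-right (left i f E) Γ⊆Δ Ξ⊆ with Ξ⊆ i
      ... | there j = left j f (cut-rightₗ E Γ⊆Δ Ξ⊆)
      -- The left rule keeps its principal formula, so the cut formula is first removed from the
      -- premises.
      ... | here refl with refl ← ▹-functional e f =
        cut-principal cuts (weakenᵣ Γ⊆Δ D) (cut-rightₗ E Γ⊆Δ Ξ⊆)

      cut-rightᵣ (conj E E′) Γ⊆Δ Ξ⊆ = conj (cut-right E Γ⊆Δ Ξ⊆) (cut-right E′ Γ⊆Δ Ξ⊆)
      cut-rightᵣ (disj₁ E)   Γ⊆Δ Ξ⊆ = disj₁ (cut-right E Γ⊆Δ Ξ⊆)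
      cut-rightᵣ (disj₂ E)   Γ⊆Δ Ξ⊆ = disj₂ (cut-right E Γ⊆Δ Ξ⊆)
      cut-rightᵣ (impl E)    Γ⊆Δ Ξ⊆ = impl (cut-right E (there ∘ Γ⊆Δ) (∷-under Ξ⊆))
      -- Modal premises have a restricted antecedent, so the recursion stops here; any remaining cut
      -- is on a part.
      cut-rightᵣ (box {p = p} E) Γ⊆Δ Ξ⊆ =
        box (cut-scope [] (boxScope L p) (closed-boxScope L p) e cuts D Γ⊆Δ Ξ⊆ E)
      cut-rightᵣ (dia {p = p} {A = A} i f l E) Γ⊆Δ Ξ⊆ with Ξ⊆ i
      ... | here refl with refl ← ▹-functional e f = cut-dia f cuts D Γ⊆Δ Ξ⊆ l E
      ... | there j =
        dia j f l (cut-scope (A ∷ []) (diaScope L p) (closed-diaScope L p) e cuts D Γ⊆Δ Ξ⊆ E)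

      cut-rightₗ (conj E) Γ⊆Δ Ξ⊆ =
        conj (cut-right E (there ∘ there ∘ Γ⊆Δ) (∷-under (∷-under Ξ⊆)))
      cut-rightₗ (disj E E′) Γ⊆Δ Ξ⊆ =
        disj (cut-right E (there ∘ Γ⊆Δ) (∷-under Ξ⊆)) (cut-right E′ (there ∘ Γ⊆Δ) (∷-under Ξ⊆))
      cut-rightₗ (impl E E′) Γ⊆Δ Ξ⊆ =
        impl (cut-right E Γ⊆Δ Ξ⊆) (cut-right E′ (there ∘ Γ⊆Δ) (∷-under Ξ⊆))

    -- Recursion on the derivation of the cut formula: left rules move below the cut until an axiom
    -- or a right rule is reached.
    cut-left : CutOn φ
    cut-left (hyp i _) E Γ⊆Δ Ξ⊆ = weaken (∈-∷⁺ʳ (Γ⊆Δ i) id ∘ Ξ⊆) E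
    cut-left (right f D) E Γ⊆Δ Ξ⊆ with refl ← ▹-functional e f = cut-right D E Γ⊆Δ Ξ⊆
    cut-left (left i f (conj D)) E Γ⊆Δ Ξ⊆ =
      left (Γ⊆Δ i) f (conj (cut-left D E (∷⁺ʳ _ (∷⁺ʳ _ Γ⊆Δ)) (∷⁺ʳ _ (there ∘ there) ∘ Ξ⊆)))
    cut-left (left i f (disj D D′)) E Γ⊆Δ Ξ⊆ =
      left (Γ⊆Δ i) f (disj (cut-left D E (∷⁺ʳ _ Γ⊆Δ) (∷⁺ʳ _ there ∘ Ξ⊆))
                           (cut-left D′ E (∷⁺ʳ _ Γ⊆Δ) (∷⁺ʳ _ there ∘ Ξ⊆)))
    -- Only the second premise has the cut formula as succedent.
    cut-left (left i f (impl D D′)) E Γ⊆Δ Ξ⊆ =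
      left (Γ⊆Δ i) f (impl (weaken Γ⊆Δ D) (cut-left D′ E (∷⁺ʳ _ Γ⊆Δ) (∷⁺ʳ _ there ∘ Ξ⊆)))

  cutOn : ∀ φ → CutOn φ
  cutOn = ▹-induction cut-left

  -- From multiset proofs to set derivations

  Derivable : Sequent Atom (language L) → Set
  Derivable (Γ ⇒ φ) = Γ ⊢ φ

  conjₗ : ∀ {φ A B Γ ψ} → φ ▹ conj A B → A ∷ B ∷ Γ ⊢ ψ → φ ∷ Γ ⊢ ψ
  conjₗ e D = left (here refl) e (conj (weaken (∷⁺ʳ _ (∷⁺ʳ _ there)) D))

  disjₗ : ∀ {φ A B Γ ψ} → φ ▹ disj A B → A ∷ Γ ⊢ ψ → B ∷ Γ ⊢ ψ → φ ∷ Γ ⊢ ψ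
  disjₗ e D E = left (here refl) e (disj (weaken (∷⁺ʳ _ there) D) (weaken (∷⁺ʳ _ there) E))

  -- The multiset rule drops the principal diamond before restricting, whereas `dia` restricts the
  -- whole antecedent; weakening absorbs the difference.
  diaᵣ : ∀ {φ χ p q A B Γ} → φ ▹ dia p A → χ ▹ dia q B → Linked L p q →
         A ∷ Γ ↾ diaScope L p ⊢ B → φ ∷ Γ ⊢ χ
  diaᵣ {p = p} e f l D =
    right f (dia (here refl) e l (weaken (∷⁺ʳ _ (↾-⊆ (diaScope L p) there)) D))

  n4⇒⊢ : ∀ {Ss S} → N4Rule Ss S → All Derivable Ss → Derivable S
  n4⇒⊢ ax   []           = hyp (here refl) var
  n4⇒⊢ ∼ax  []           = hyp (here refl) ∼var
  -- Weakening supplies the second copy of the part.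
  n4⇒⊢ ∼∼ₗ  (D ∷ [])     = conjₗ ∼∼ (weaken (∷⁺ʳ _ there) D)
  n4⇒⊢ ∼∼ᵣ  (D ∷ [])     = right ∼∼ (conj D D)
  n4⇒⊢ ∧ₗ   (D ∷ [])     = conjₗ ∧▹ D
  n4⇒⊢ ∧ᵣ   (D ∷ E ∷ []) = right ∧▹ (conj D E)
  n4⇒⊢ ∨ₗ   (D ∷ E ∷ []) = disjₗ ∨▹ D E
  n4⇒⊢ ∨ᵣ₁  (D ∷ [])     = right ∨▹ (disj₁ D)
  n4⇒⊢ ∨ᵣ₂  (D ∷ [])     = right ∨▹ (disj₂ D)
  n4⇒⊢ ∼∨ₗ  (D ∷ [])     = conjₗ ∼∨ D
  n4⇒⊢ ∼∨ᵣ  (D ∷ E ∷ []) = right ∼∨ (conj D E)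
  n4⇒⊢ ∼∧ₗ  (D ∷ E ∷ []) = disjₗ ∼∧ D E
  n4⇒⊢ ∼∧ᵣ₁ (D ∷ [])     = right ∼∧ (disj₁ D)
  n4⇒⊢ ∼∧ᵣ₂ (D ∷ [])     = right ∼∧ (disj₂ D)
  n4⇒⊢ ⊃ₗ   (D ∷ E ∷ []) = left (here refl) ⊃▹ (impl D (weaken (∷⁺ʳ _ there) E))
  n4⇒⊢ ⊃ᵣ   (D ∷ [])     = right ⊃▹ (impl D)
  n4⇒⊢ ∼⊃ₗ  (D ∷ [])     = conjₗ ∼⊃ D
  n4⇒⊢ ∼⊃ᵣ  (D ∷ E ∷ []) = right ∼⊃ (conj D E)

-- Scopes and links compute only for a concrete calculus; then each premise agrees with that of
-- `box` or `dia` definitionally.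
modal⇒⊢ : ∀ {Atom} L {r Ss} {S : Sequent Atom (language L)} → r ∈ modalRules L →
          ModalRule r Ss S → All (Derivable L) Ss → Derivable L S
modal⇒⊢ GCN4K (here refl) □-rule (D ∷ []) = right □▹ (box D)
modal⇒⊢ GCN4K (there (here refl)) ◇-rule (D ∷ []) = diaᵣ _ ◇▹ ◇▹ refl D
modal⇒⊢ GCN4K (there (there (here refl))) □∼-rule (D ∷ []) = diaᵣ _ ∼□ ∼□ refl D
modal⇒⊢ GCN4K (there (there (there (here refl)))) ◇∼-rule (D ∷ []) = right ∼◇ (box D)
modal⇒⊢ GCN4K± (here refl) □-rule (D ∷ []) = right □▹ (box D)
modal⇒⊢ GCN4K± (there (here refl)) ◇±-rule (D ∷ []) = diaᵣ _ ◇▹ ◇▹ refl D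
modal⇒⊢ GCN4K± (there (there (here refl))) □∼±-rule (D ∷ []) = diaᵣ _ ∼□ ∼□ refl D
modal⇒⊢ GCN4K± (there (there (there (here refl)))) ◇∼-rule (D ∷ []) = right ∼◇ (box D)
modal⇒⊢ GCN4K⋎ (here refl) □-rule (D ∷ []) = right □▹ (box D)
modal⇒⊢ GCN4K⋎ (there (here refl)) ◇⋎-rule (D ∷ []) = diaᵣ _ ◇▹ ◇▹ refl D
modal⇒⊢ GCN4K⋎ (there (there (here refl))) □∼⋎-rule (D ∷ []) = diaᵣ _ ∼□ ∼□ refl D
modal⇒⊢ GCN4K⋎ (there (there (there (here refl)))) ◇∼-rule (D ∷ []) = right ∼◇ (box D)
modal⇒⊢ GCN4K⋈ (here refl) □⋈-rule (D ∷ []) = right □▹ (box D)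
modal⇒⊢ GCN4K⋈ (there (here refl)) ◇-rule (D ∷ []) = diaᵣ _ ◇▹ ◇▹ tt D
modal⇒⊢ GCN4K⋈ (there (there (here refl))) ◇⋈-rule (D ∷ []) = diaᵣ _ ∼□ ◇▹ tt D
modal⇒⊢ GCN4K⋈ (there (there (there (here refl)))) □∼-rule (D ∷ []) = diaᵣ _ ∼□ ∼□ tt D
modal⇒⊢ GCN4K⋈ (there (there (there (there (here refl))))) □∼⋈-rule (D ∷ []) =
  diaᵣ _ ◇▹ ∼□ tt D
modal⇒⊢ GCN4K⋈ (there (there (there (there (there (here refl)))))) ◇∼⋈-rule (D ∷ []) =
  right ∼◇ (box D)
modal⇒⊢ GCN4K¹ (here refl) □⋈-rule (D ∷ []) = right □▹ (box D)
modal⇒⊢ GCN4K¹ (there (here refl)) ◇¹-rule (D ∷ []) = diaᵣ _ ◇▹ ◇▹ tt D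
modal⇒⊢ GCN4K¹ (there (there (here refl))) ◇¹⋈-rule (D ∷ []) = diaᵣ _ ∼□ ◇▹ tt D
modal⇒⊢ GCN4K¹ (there (there (there (here refl)))) □∼¹-rule (D ∷ []) = diaᵣ _ ∼□ ∼□ tt D
modal⇒⊢ GCN4K¹ (there (there (there (there (here refl))))) □∼¹⋈-rule (D ∷ []) =
  diaᵣ _ ◇▹ ∼□ tt D
modal⇒⊢ GCN4K¹ (there (there (there (there (there (here refl)))))) ◇∼⋈-rule (D ∷ []) =
  right ∼◇ (box D)

proof⇒⊢ : ∀ {Atom} L {S : Sequent Atom (language L)} → Proof L S → Derivable L S
proofs⇒⊢ : ∀ {Atom} L {Ss : List (Sequent Atom (language L))} →
           All (Proof L) Ss → All (Derivable L) Ss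
proof⇒⊢ L (node (n4 r) π Ds) =
  weaken L (⊆-reflexive-↭ (↭-sym π)) (n4⇒⊢ L r (proofs⇒⊢ L Ds))
proof⇒⊢ L (node (modal i r) π Ds) =
  weaken L (⊆-reflexive-↭ (↭-sym π)) (modal⇒⊢ L i r (proofs⇒⊢ L Ds))
proofs⇒⊢ L []       = []
proofs⇒⊢ L (D ∷ Ds) = proof⇒⊢ L D ∷ proofs⇒⊢ L Ds

-- Rules of the calculi recovered from shapes

boxRule : ∀ {Atom} L {Γ : List (Formula Atom (language L))} {φ p A} → φ ▹ box p A →
          Rule L ((Γ ↾ boxScope L p ⇒ A) ∷ []) (Γ ⇒ φ)
boxRule GCN4K  □▹ = modal (here refl) □-rule
boxRule GCN4K  ∼◇ = modal (there (there (there (here refl)))) ◇∼-rule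
boxRule GCN4K± □▹ = modal (here refl) □-rule
boxRule GCN4K± ∼◇ = modal (there (there (there (here refl)))) ◇∼-rule
boxRule GCN4K⋎ □▹ = modal (here refl) □-rule
boxRule GCN4K⋎ ∼◇ = modal (there (there (there (here refl)))) ◇∼-rule
boxRule GCN4K⋈ □▹ = modal (here refl) □⋈-rule
boxRule GCN4K⋈ ∼◇ = modal (there (there (there (there (there (here refl)))))) ◇∼⋈-rule
boxRule GCN4K¹ □▹ = modal (here refl) □⋈-rule
boxRule GCN4K¹ ∼◇ = modal (there (there (there (there (there (here refl)))))) ◇∼⋈-rule

-- Mixed signs arise only in `GCN4K⋈` and `GCN4K¹`; elsewhere `Linked` excludes them.
diaRule : ∀ {Atom} L {Γ : List (Formula Atom (language L))} {φ χ p q A B} →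
          φ ▹ dia p A → χ ▹ dia q B → Linked L p q →
          Rule L ((A ∷ Γ ↾ diaScope L p ⇒ B) ∷ []) (φ ∷ Γ ⇒ χ)
diaRule GCN4K  ◇▹ ◇▹ _ = modal (there (here refl)) ◇-rule
diaRule GCN4K  ∼□ ∼□ _ = modal (there (there (here refl))) □∼-rule
diaRule GCN4K± ◇▹ ◇▹ _ = modal (there (here refl)) ◇±-rule
diaRule GCN4K± ∼□ ∼□ _ = modal (there (there (here refl))) □∼±-rule
diaRule GCN4K⋎ ◇▹ ◇▹ _ = modal (there (here refl)) ◇⋎-rule
diaRule GCN4K⋎ ∼□ ∼□ _ = modal (there (there (here refl))) □∼⋎-rule
diaRule GCN4K⋈ ◇▹ ◇▹ _ = modal (there (here refl)) ◇-rule
diaRule GCN4K⋈ ∼□ ◇▹ _ = modal (there (there (here refl))) ◇⋈-rule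
diaRule GCN4K⋈ ∼□ ∼□ _ = modal (there (there (there (here refl)))) □∼-rule
diaRule GCN4K⋈ ◇▹ ∼□ _ = modal (there (there (there (there (here refl))))) □∼⋈-rule
diaRule GCN4K¹ ◇▹ ◇▹ _ = modal (there (here refl)) ◇¹-rule
diaRule GCN4K¹ ∼□ ◇▹ _ = modal (there (there (here refl))) ◇¹⋈-rule
diaRule GCN4K¹ ∼□ ∼□ _ = modal (there (there (there (here refl)))) □∼¹-rule
diaRule GCN4K¹ ◇▹ ∼□ _ = modal (there (there (there (there (here refl))))) □∼¹⋈-rule

module _ {Atom : Set} {ℓ : Language} {Γ : List (Formula Atom ℓ)} where

  litRule : ∀ {φ} → φ ▹ lit → N4Rule [] (φ ∷ Γ ⇒ φ)
  litRule var  = ax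
  litRule ∼var = ∼ax

  -- `∼∼ₗ` has one copy of the part where the shape has two, hence an inclusion instead of a fixed
  -- premise.
  conjRuleₗ : ∀ {φ A B ψ} → φ ▹ conj A B →
              ∃ λ Θ → A ∷ B ∷ Γ ⊆ Θ × N4Rule ((Θ ⇒ ψ) ∷ []) (φ ∷ Γ ⇒ ψ)
  conjRuleₗ ∼∼ = _ , ∈-∷⁺ʳ (here refl) id , ∼∼ₗ
  conjRuleₗ ∧▹ = _ , id , ∧ₗ
  conjRuleₗ ∼∨ = _ , id , ∼∨ₗ
  conjRuleₗ ∼⊃ = _ , id , ∼⊃ₗ

  -- `∼∼ᵣ` has one premise where the other rules have two, hence the existential over premise lists.
  conjRuleᵣ : ∀ {φ A B} {P : Sequent Atom ℓ → Set} → φ ▹ conj A B → P (Γ ⇒ A) → P (Γ ⇒ B) →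
              ∃ λ Ss → All P Ss × N4Rule Ss (Γ ⇒ φ)
  conjRuleᵣ ∼∼ D _ = _ , D ∷ [] , ∼∼ᵣ
  conjRuleᵣ ∧▹ D E = _ , D ∷ E ∷ [] , ∧ᵣ
  conjRuleᵣ ∼∨ D E = _ , D ∷ E ∷ [] , ∼∨ᵣ
  conjRuleᵣ ∼⊃ D E = _ , D ∷ E ∷ [] , ∼⊃ᵣ

  disjRuleₗ : ∀ {φ A B ψ} → φ ▹ disj A B →
              N4Rule ((A ∷ Γ ⇒ ψ) ∷ (B ∷ Γ ⇒ ψ) ∷ []) (φ ∷ Γ ⇒ ψ)
  disjRuleₗ ∨▹ = ∨ₗ
  disjRuleₗ ∼∧ = ∼∧ₗ

  disjRuleᵣ₁ : ∀ {φ A B} → φ ▹ disj A B → N4Rule ((Γ ⇒ A) ∷ []) (Γ ⇒ φ)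
  disjRuleᵣ₁ ∨▹ = ∨ᵣ₁
  disjRuleᵣ₁ ∼∧ = ∼∧ᵣ₁

  disjRuleᵣ₂ : ∀ {φ A B} → φ ▹ disj A B → N4Rule ((Γ ⇒ B) ∷ []) (Γ ⇒ φ)
  disjRuleᵣ₂ ∨▹ = ∨ᵣ₂
  disjRuleᵣ₂ ∼∧ = ∼∧ᵣ₂

  implRuleₗ : ∀ {φ A B ψ} → φ ▹ impl A B →
              N4Rule ((φ ∷ Γ ⇒ A) ∷ (B ∷ Γ ⇒ ψ) ∷ []) (φ ∷ Γ ⇒ ψ)
  implRuleₗ ⊃▹ = ⊃ₗ

  implRuleᵣ : ∀ {φ A B} → φ ▹ impl A B → N4Rule ((A ∷ Γ ⇒ B) ∷ []) (Γ ⇒ φ)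
  implRuleᵣ ⊃▹ = ⊃ᵣ

-- From set derivations back to multiset proofs

module _ {Atom : Set} {ℓ : Language} where

  private F = Formula Atom ℓ

  -- `Covers Δ φ`: left rules applied to an antecedent containing φ can, along
  -- some branch, have turned it into Δ.
  data Covers (Δ : List F) : F → Set
  data CoversShape (Δ : List F) : Shape F → Set

  data Covers Δ where
    member : ∀ {φ} → φ ∈ Δ → Covers Δ φ
    shape  : ∀ {φ s} → φ ▹ s → CoversShape Δ s → Covers Δ φ

  -- An implication is decomposed only along the second premise of `⊃ₗ`; the first premise retains
  -- it.
  data CoversShape Δ where
    conj  : ∀ {A B} → Covers Δ A → Covers Δ B → CoversShape Δ (conj A B)
    disj₁ : ∀ {A B} → Covers Δ A → CoversShape Δ (disj A B)
    disj₂ : ∀ {A B} → Covers Δ B → CoversShape Δ (disj A B)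
    impl  : ∀ {A B} → Covers Δ B → CoversShape Δ (impl A B)

  CoversAll : List F → List F → Set
  CoversAll Δ Γ = ∀ {φ} → φ ∈ Γ → Covers Δ φ

  covers-trans : ∀ {Θ Δ φ} → CoversAll Θ Δ → Covers Δ φ → Covers Θ φ
  coversShape-trans : ∀ {Θ Δ s} → CoversAll Θ Δ → CoversShape Δ s → CoversShape Θ s
  covers-trans g (member i)  = g i
  covers-trans g (shape e c) = shape e (coversShape-trans g c)
  coversShape-trans g (conj c d) = conj (covers-trans g c) (covers-trans g d)
  coversShape-trans g (disj₁ c)  = disj₁ (covers-trans g c)
  coversShape-trans g (disj₂ c)  = disj₂ (covers-trans g c)
  coversShape-trans g (impl c)   = impl (covers-trans g c)

  covers-∷ : ∀ {Δ Γ φ} → Covers Δ φ → CoversAll Δ Γ → CoversAll Δ (φ ∷ Γ)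
  covers-∷ c g (here refl) = c
  covers-∷ c g (there i)   = g i

  covers-under : ∀ {Δ Γ φ} → CoversAll Δ Γ → CoversAll (φ ∷ Δ) (φ ∷ Γ)
  covers-under g = covers-∷ (member (here refl)) (covers-trans (member ∘ there) ∘ g)

  -- Used after each decomposing left rule: the principal formula is covered by its parts, and
  -- everything else is still present.
  covers-replace : ∀ {Δ Γ Δ′ Θ φ s} → CoversAll Δ Γ → Δ ⊆ φ ∷ Δ′ → φ ▹ s → CoversShape Θ s →
                   Δ′ ⊆ Θ → CoversAll Θ Γ
  covers-replace g Δ⊆ e c Δ′⊆Θ =
    covers-trans (covers-∷ (shape e c) (member ∘ Δ′⊆Θ) ∘ Δ⊆) ∘ g

  -- Literals, boxes and diamonds are never decomposed by left rules, so for them being covered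
  -- means being present.
  covers-member : ∀ {Δ φ s} → φ ▹ s → (CoversShape Δ s → ⊥) → Covers Δ φ → φ ∈ Δ
  covers-member e ¬c (member i) = i
  covers-member e ¬c (shape f c) with refl ← ▹-functional e f with () ← ¬c c

  covers-↾ : ∀ c {Δ Γ} → CoversAll Δ Γ → Γ ↾ c ⊆ Δ ↾ c
  covers-↾ c {Δ} {Γ} g i with ∈-↾⁻ c Γ i
  ... | p , v , φ , j , e = ∈-↾⁺ Δ v (φ , covers-member e (λ ()) (g j) , e)

∈⇒↭∷ : ∀ {A : Set} {x : A} {xs} → x ∈ xs → ∃ λ ys → xs ↭ x ∷ ys
∈⇒↭∷ i with ys , zs , refl ← ∈-∃++ i = ys ++ zs , shift _ ys zs

module _ {Atom : Set} (L : Calculus) where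

  ⊢⇒proof : ∀ {Γ Δ} {ψ : Formula Atom (language L)} → _⊢_ L Γ ψ → CoversAll Δ Γ →
            Proof L (Δ ⇒ ψ)
  ⊢⇒proof (hyp i e) g with _ , π ← ∈⇒↭∷ (covers-member e (λ ()) (g i)) = node (n4 (litRule e)) π []
  ⊢⇒proof (right e (conj D E)) g
    with _ , Ds , r ← conjRuleᵣ {P = Proof L} e (⊢⇒proof D g) (⊢⇒proof E g) =
    node (n4 r) ↭-refl Ds
  ⊢⇒proof (right e (disj₁ D)) g = node (n4 (disjRuleᵣ₁ e)) ↭-refl (⊢⇒proof D g ∷ [])
  ⊢⇒proof (right e (disj₂ D)) g = node (n4 (disjRuleᵣ₂ e)) ↭-refl (⊢⇒proof D g ∷ [])
  ⊢⇒proof (right e (impl D)) g =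
    node (n4 (implRuleᵣ e)) ↭-refl (⊢⇒proof D (covers-under g) ∷ [])
  ⊢⇒proof (right e (box {p = p} D)) g =
    node (boxRule L e) ↭-refl (⊢⇒proof D (member ∘ covers-↾ (boxScope L p) g) ∷ [])
  ⊢⇒proof (right e (dia {p = p} i f l D)) g with _ , π ← ∈⇒↭∷ (covers-member f (λ ()) (g i)) =
    node (diaRule L f e l) π
      -- The principal diamond is removed before restricting; being no box, it takes nothing away.
      (⊢⇒proof D (member ∘ ∷⁺ʳ _ (↾-⊆-unseen c f (λ ()) (⊆-reflexive-↭ π) ∘ covers-↾ c g)) ∷ [])
    where c = diaScope L p
  ⊢⇒proof (left i e D) g with g i
  ⊢⇒proof (left i e (conj D)) g | member j
    with _ , π ← ∈⇒↭∷ j with _ , Θ⊇ , r ← conjRuleₗ e =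
    node (n4 r) π
      (⊢⇒proof D (covers-∷ a (covers-∷ b
        (covers-replace g (⊆-reflexive-↭ π) e (conj a b) (Θ⊇ ∘ there ∘ there)))) ∷ [])
    where
    a = member (Θ⊇ (here refl))
    b = member (Θ⊇ (there (here refl)))
  ⊢⇒proof (left i e (disj D E)) g | member j with _ , π ← ∈⇒↭∷ j =
    node (n4 (disjRuleₗ e)) π
      ( ⊢⇒proof D (covers-∷ a (covers-replace g (⊆-reflexive-↭ π) e (disj₁ a) there))
      ∷ ⊢⇒proof E (covers-∷ a (covers-replace g (⊆-reflexive-↭ π) e (disj₂ a) there))
      ∷ [])
    where
    a : ∀ {φ Δ} → Covers (φ ∷ Δ) φ
    a = member (here refl)
  ⊢⇒proof (left i e (impl D E)) g | member j with _ , π ← ∈⇒↭∷ j =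
    node (n4 (implRuleₗ e)) π
      -- This premise retains the implication, so its antecedent is `Δ` up to order.
      ( ⊢⇒proof D (covers-trans (member ∘ ⊆-reflexive-↭ π) ∘ g)
      ∷ ⊢⇒proof E (covers-∷ a (covers-replace g (⊆-reflexive-↭ π) e (impl a) there))
      ∷ [])
    where
    a = member (here refl)
  -- The principal formula has been decomposed already: no rule is applied, and the covering selects
  -- the premise to follow.
  ⊢⇒proof (left i e D) g | shape f c with refl ← ▹-functional e f with D | c
  ... | conj D   | conj a b = ⊢⇒proof D (covers-∷ a (covers-∷ b g))
  ... | disj D _ | disj₁ a  = ⊢⇒proof D (covers-∷ a g)
  ... | disj _ E | disj₂ b  = ⊢⇒proof E (covers-∷ b g)
  ... | impl _ E | impl b   = ⊢⇒proof E (covers-∷ b g)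

theorem5 : (Atom : Set) → Atom ↣ ℕ → (L : Calculus) → Admissible {Atom} L Cut
theorem5 _ _ L (cut {Γ} {φ = φ}) (D ∷ E ∷ []) =
  -- Both premises weaken into the joint antecedent, which covers itself trivially by `member`.
  ⊢⇒proof L
    (cutOn L φ (proof⇒⊢ L D) (proof⇒⊢ L E) ∈-++⁺ˡ (∷⁺ʳ φ (xs⊆ys++xs _ Γ)))
    member
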